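{- For each term $M\in\Lambda_A$ (the affine $\lambda$-calculus), the function $\varepsilon\mapsto\mathsf{ExpLen}_M(\varepsilon)$ on $[0,1]$ has its minimum at $\varepsilon=1$; that is, $\mathsf{ExpLen}_M(1)\le\mathsf{ExpLen}_M(\varepsilon)$ for all $\varepsilon\in[0,1]$.
   Context: $\lambda$-terms: $\Lambda$ is the set of untyped $\lambda$-terms $M,N ::= x \mid MN \mid \lambda x.M$ ($x$ in a countably infinite set of variables), modulo $\alpha$-equivalence. A $\beta$-redex is a term $(\lambda x.M)N$; its contractum is $M\{N/x\}$ (capture-avoiding substitution). $M\to_\beta N$ means that $N$ is obtained from $M$ by replacing one occurrence of a redex in $M$ (anywhere in the term) by its contractum. A term is in normal form if it has no $\beta$-reduct, reducible otherwise. $\Lambda_A$ (the $\lambda A$-calculus) is the set of terms such that for every subterm $\lambda x.N$, the variable $x$ occurs free at most once in $N$; it is closed under $\beta$-reduction. The leftmost-outermost ($\mathsf{LO}$) redex of a reducible term is the leftmost among its redexes, and the rightmost-innermost ($\mathsf{RI}$) redex is the rightmost among its redexes, the position of a redex being measured by its beginning symbol in the written term. $\mathsf{LO}(M)$, $\mathsf{RI}(M)$ denote the terms obtained from $M$ by firing these redexes. For $\varepsilon\in[0,1]$, the randomised strategy $\mathsf{P}_\varepsilon$ assigns to each reducible term $M$ the distribution $\mathsf{P}_\varepsilon(M)=\varepsilon\,\delta_{\mathsf{LO}(M)}+(1-\varepsilon)\,\delta_{\mathsf{RI}(M)}$; it is undefined on normal forms. Put $\mathbb{P}(M\to N)=\mathsf{P}_\varepsilon(M)(N)$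 if $M$ is reducible, $0$ if $M$ is a normal form. The computation starting from $M$ is the sequence $(\rho_i)_{i\in\mathbb{N}}$ with $\rho_0$ the Dirac distribution at $M$ and $\rho_{i+1}(N)=\sum_{L}\rho_i(L)\,\mathbb{P}(L\to N)$. Write $|\rho|=\sum_N\rho(N)$ and $\mathsf{ExpLen}_M(\varepsilon)=\sum_{i=1}^\infty|\rho_i|\in\mathbb{R}\cup\{+\infty\}$. -}

module Defs where

open import Data.Empty using (⊥-elim)
open import Data.List.Base
  using (List; []; _∷_; _++_; map; foldr; concatMap; deduplicate)
open import Data.List.Extrema.Nat using (argmin; argmax)
open import Data.List.Membership.Propositional using (_∈_; _∉_)
open import Data.List.Membership.Propositional.Properties
  using (∈-map⁺; ∈-++⁺ˡ; ∈-++⁺ʳ; ∈-concatMap⁺; ∈-deduplicate⁺)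
open import Data.List.Relation.Unary.All using ([])
open import Data.List.Relation.Unary.AllPairs using ([]; _∷_)
open import Data.List.Relation.Unary.Any as Any using (here; there)
open import Data.List.Relation.Unary.Unique.Propositional using (Unique)
import Data.List.Relation.Unary.Unique.DecPropositional.Properties as UniqueDec
open import Data.Nat.Base as ℕ using (ℕ; zero; suc)
import Data.Nat.Properties as ℕ
open import Data.Product.Base using (∃; _×_; _,_; proj₁; proj₂)
open import Data.Rational.Base as ℚ using (ℚ; 0ℚ; 1ℚ; ½; ∣_∣)
import Data.Rational.Properties as ℚ
open import Data.Rational.Solver using (module +-*-Solver)
open import Function.Base using (_∘_)
open import Relation.Binary.PropositionalEquality
  using (_≡_; _≢_; refl; sym; trans; cong; cong₂; subst)
open import Relation.Nullary.Decidable using (Dec; yes; no; map′; _×-dec_)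
open import Relation.Nullary.Negation using (contradiction)

------------------------------------------------------------------------
-- Untyped λ-terms modulo α-equivalence, with de Bruijn indices.  The free
-- variables of a term are the indices not captured by a λ.

infixl 7 _·_
infix  6 ƛ_

data Term : Set where
  var : ℕ → Term
  _·_ : Term → Term → Term
  ƛ_  : Term → Term

var-injective : ∀ {x y} → var x ≡ var y → x ≡ y
var-injective refl = refl

ƛ-injective : ∀ {M N} → ƛ M ≡ ƛ N → M ≡ N
ƛ-injective refl = refl

·-injective : ∀ {M N M′ N′} → M · N ≡ M′ · N′ → M ≡ M′ × N ≡ N′
·-injective refl = refl , refl

infix 4 _≟_

_≟_ : (M N : Term) → Dec (M ≡ N)
var x   ≟ var y     = map′ (cong var) var-injective (x ℕ.≟ y)
var _   ≟ (_ · _)   = no λ ()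
var _   ≟ (ƛ _)     = no λ ()
(_ · _) ≟ var _     = no λ ()
(M · N) ≟ (M′ · N′) =
  map′ (λ (p , q) → cong₂ _·_ p q) ·-injective (M ≟ M′ ×-dec N ≟ N′)
(_ · _) ≟ (ƛ _)     = no λ ()
(ƛ _)   ≟ var _     = no λ ()
(ƛ _)   ≟ (_ · _)   = no λ ()
(ƛ M)   ≟ (ƛ N)     = map′ (cong ƛ_) ƛ-injective (M ≟ N)

ext : (ℕ → ℕ) → ℕ → ℕ
ext f zero    = zero
ext f (suc x) = suc (f x)

rename : (ℕ → ℕ) → Term → Term
rename f (var x) = var (f x)
rename f (M · N) = rename f M · rename f N
rename f (ƛ M)   = ƛ rename (ext f) M

exts : (ℕ → Term) → ℕ → Term
exts σ zero    = var zero
exts σ (suc x) = rename suc (σ x)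

substitute : (ℕ → Term) → Term → Term
substitute σ (var x) = σ x
substitute σ (M · N) = substitute σ M · substitute σ N
substitute σ (ƛ M)   = ƛ substitute (exts σ) M

_/0 : Term → ℕ → Term
(N /0) zero    = N
(N /0) (suc x) = var x

infix 8 _[_]

_[_] : Term → Term → Term
M [ N ] = substitute (N /0) M

------------------------------------------------------------------------

occurrences : ℕ → Term → ℕ
occurrences x (var y) with x ℕ.≟ y
... | yes _ = 1
... | no  _ = 0
occurrences x (M · N) = occurrences x M ℕ.+ occurrences x N
occurrences x (ƛ M)   = occurrences (suc x) M

infix 4 _⊑_

data _⊑_ (S : Term) : Term → Set where
  self  : S ⊑ S
  body  : ∀ {M} → S ⊑ M → S ⊑ ƛ M
  left  : ∀ {M N} → S ⊑ M → S ⊑ M · N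
  right : ∀ {M N} → S ⊑ N → S ⊑ M · N

Affine : Term → Set
Affine M = ∀ N → ƛ N ⊑ M → occurrences 0 N ℕ.≤ 1

------------------------------------------------------------------------

data Redex : Term → Set where
  root  : ∀ {M N} → Redex ((ƛ M) · N)
  body  : ∀ {M} → Redex M → Redex (ƛ M)
  left  : ∀ {M N} → Redex M → Redex (M · N)
  right : ∀ {M N} → Redex N → Redex (M · N)

fire : ∀ {M} → Redex M → Term
fire (root {M} {N})  = M [ N ]
fire (body R)        = ƛ fire R
fire (left {N = N} R)  = fire R · N
fire (right {M = M} R) = M · fire R

infix 4 _⟶β_

_⟶β_ : Term → Term → Set
M ⟶β N = ∃ λ (R : Redex M) → fire R ≡ N

Reducible : Term → Set
Reducible M = ∃ λ N → M ⟶β N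

rootRedexes : ∀ M N → List (Redex (M · N))
rootRedexes (var _) _ = []
rootRedexes (_ · _) _ = []
rootRedexes (ƛ _)   _ = root ∷ []

redexes : ∀ M → List (Redex M)
redexes (var _) = []
redexes (M · N) = rootRedexes M N ++ map left (redexes M) ++ map right (redexes N)
redexes (ƛ M)   = map body (redexes M)

∈-redexes : ∀ {M} (R : Redex M) → R ∈ redexes M
∈-redexes root      = here refl
∈-redexes (body R)  = ∈-map⁺ body (∈-redexes R)
∈-redexes (left {M} {N} R) =
  ∈-++⁺ʳ (rootRedexes M N) (∈-++⁺ˡ (∈-map⁺ left (∈-redexes R)))
∈-redexes (right {M} {N} R) =
  ∈-++⁺ʳ (rootRedexes M N)
    (∈-++⁺ʳ (map left (redexes M)) (∈-map⁺ right (∈-redexes R)))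

reducible? : ∀ M → Dec (Reducible M)
reducible? M with redexes M | ∈-redexes {M}
... | []    | complete = no λ (_ , R , _) → contradiction (complete R) λ ()
... | R ∷ _ | _        = yes (fire R , R , refl)

-- Terms are written with applications as “(MN)” and abstractions as
-- “λx.M”, every parenthesis, λ, dot and variable being one symbol.

writtenLength : Term → ℕ
writtenLength (var _) = 1
writtenLength (M · N) = 1 ℕ.+ writtenLength M ℕ.+ writtenLength N ℕ.+ 1
writtenLength (ƛ M)   = 3 ℕ.+ writtenLength M

-- The number of symbols before the first symbol of the redex.

start : ∀ {M} → Redex M → ℕ
start root              = 0
start (body R)          = 3 ℕ.+ start R
start (left R)          = 1 ℕ.+ start R
start (right {M = M} R) = 1 ℕ.+ writtenLength M ℕ.+ start R

-- Distinct redexes start at distinct symbols, so these do not depend on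
-- the redex supplied by the proof of reducibility.

leftmost : ∀ M → Reducible M → Redex M
leftmost M (_ , R , _) = argmin start R (redexes M)

rightmost : ∀ M → Reducible M → Redex M
rightmost M (_ , R , _) = argmax start R (redexes M)

LO : ∀ M → Reducible M → Term
LO M r = fire (leftmost M r)

RI : ∀ M → Reducible M → Term
RI M r = fire (rightmost M r)

------------------------------------------------------------------------
-- Real numbers, as Cauchy sequences of rationals

CauchySeq : (ℕ → ℚ) → Set
CauchySeq x = ∀ δ → 0ℚ ℚ.< δ →
  ∃ λ K → ∀ m n → K ℕ.≤ m → K ℕ.≤ n → ∣ x m ℚ.- x n ∣ ℚ.< δ

record ℝ : Set where
  constructor real
  field
    seq    : ℕ → ℚ
    cauchy : CauchySeq seq

open ℝ public

infix 4 _≃ℝ_ _≤ℝ_ _<ℝ_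

_≃ℝ_ : ℝ → ℝ → Set
x ≃ℝ y = ∀ δ → 0ℚ ℚ.< δ →
  ∃ λ K → ∀ n → K ℕ.≤ n → ∣ seq x n ℚ.- seq y n ∣ ℚ.< δ

_≤ℝ_ : ℝ → ℝ → Set
x ≤ℝ y = ∀ δ → 0ℚ ℚ.< δ →
  ∃ λ K → ∀ n → K ℕ.≤ n → seq x n ℚ.≤ seq y n ℚ.+ δ

_<ℝ_ : ℝ → ℝ → Set
x <ℝ y = ∃ λ δ → 0ℚ ℚ.< δ ×
  ∃ λ K → ∀ n → K ℕ.≤ n → seq x n ℚ.+ δ ℚ.≤ seq y n

module S = +-*-Solver

∣p-p∣≡0 : ∀ p → ∣ p ℚ.- p ∣ ≡ 0ℚ
∣p-p∣≡0 p = cong ∣_∣ (ℚ.+-inverseʳ p)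

half-pos : ∀ {δ} → 0ℚ ℚ.< δ → 0ℚ ℚ.< ½ ℚ.* δ
half-pos {δ} 0<δ = ℚ.positive⁻¹ (½ ℚ.* δ) {{ℚ.pos*pos⇒pos ½ δ {{ℚ.positive 0<δ}}}}

halves : ∀ δ → ½ ℚ.* δ ℚ.+ ½ ℚ.* δ ≡ δ
halves = S.solve 1 (λ d → S.con ½ S.:* d S.:+ S.con ½ S.:* d S.:= d) refl

⊔-≤ˡ : ∀ {k l m} → k ℕ.⊔ l ℕ.≤ m → k ℕ.≤ m
⊔-≤ˡ {k} {l} = ℕ.≤-trans (ℕ.m≤m⊔n k l)

⊔-≤ʳ : ∀ {k l m} → k ℕ.⊔ l ℕ.≤ m → l ℕ.≤ m
⊔-≤ʳ {k} {l} = ℕ.≤-trans (ℕ.m≤n⊔m k l)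

const-cauchy : ∀ p → CauchySeq (λ _ → p)
const-cauchy p δ 0<δ =
  0 , λ _ _ _ _ → subst (ℚ._< δ) (sym (∣p-p∣≡0 p)) 0<δ

neg-cauchy : ∀ x → CauchySeq x → CauchySeq (ℚ.-_ ∘ x)
neg-cauchy x cx δ 0<δ with cx δ 0<δ
... | K , c = K , λ m n K≤m K≤n →
  subst (ℚ._< δ) (lemma (x m) (x n)) (c m n K≤m K≤n)
  where
  lemma : ∀ p q → ∣ p ℚ.- q ∣ ≡ ∣ ℚ.- p ℚ.- ℚ.- q ∣
  lemma p q = trans (sym (ℚ.∣-p∣≡∣p∣ (p ℚ.- q)))
    (cong ∣_∣ (S.solve 2 (λ p q → S.:- (p S.:- q) S.:= S.:- p S.:- S.:- q) refl p q))

+-cauchy : ∀ x y → CauchySeq x → CauchySeq y → CauchySeq (λ n → x n ℚ.+ y n)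
+-cauchy x y cx cy δ 0<δ
  with cx (½ ℚ.* δ) (half-pos 0<δ) | cy (½ ℚ.* δ) (half-pos 0<δ)
... | K , c | L , d = K ℕ.⊔ L , λ m n h i → begin-strict
  ∣ (x m ℚ.+ y m) ℚ.- (x n ℚ.+ y n) ∣     ≡⟨ cong ∣_∣ (rearrange (x m) (y m) (x n) (y n)) ⟩
  ∣ (x m ℚ.- x n) ℚ.+ (y m ℚ.- y n) ∣     ≤⟨ ℚ.∣p+q∣≤∣p∣+∣q∣ (x m ℚ.- x n) (y m ℚ.- y n) ⟩
  ∣ x m ℚ.- x n ∣ ℚ.+ ∣ y m ℚ.- y n ∣     <⟨ ℚ.+-mono-< (c m n (⊔-≤ˡ h) (⊔-≤ˡ i)) (d m n (⊔-≤ʳ {K} h) (⊔-≤ʳ {K} i)) ⟩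
  ½ ℚ.* δ ℚ.+ ½ ℚ.* δ                     ≡⟨ halves δ ⟩
  δ                                       ∎
  where
  open ℚ.≤-Reasoning
  rearrange : ∀ p q r s → (p ℚ.+ q) ℚ.- (r ℚ.+ s) ≡ (p ℚ.- r) ℚ.+ (q ℚ.- s)
  rearrange = S.solve 4
    (λ p q r s → (p S.:+ q) S.:- (r S.:+ s) S.:= (p S.:- r) S.:+ (q S.:- s)) refl

bounded : ∀ x → CauchySeq x →
          ∃ λ B → 0ℚ ℚ.< B × ∃ λ K → ∀ n → K ℕ.≤ n → ∣ x n ∣ ℚ.≤ B
bounded x cx with cx 1ℚ (ℚ.positive⁻¹ 1ℚ)
... | K , c = 1ℚ ℚ.+ ∣ x K ∣ , ℚ.+-mono-<-≤ (ℚ.positive⁻¹ 1ℚ) (ℚ.0≤∣p∣ (x K)) ,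
              K , λ n K≤n → begin
  ∣ x n ∣                       ≡⟨ cong ∣_∣ (rearrange (x n) (x K)) ⟩
  ∣ (x n ℚ.- x K) ℚ.+ x K ∣     ≤⟨ ℚ.∣p+q∣≤∣p∣+∣q∣ (x n ℚ.- x K) (x K) ⟩
  ∣ x n ℚ.- x K ∣ ℚ.+ ∣ x K ∣   ≤⟨ ℚ.+-monoˡ-≤ ∣ x K ∣ (ℚ.<⇒≤ (c n K K≤n ℕ.≤-refl)) ⟩
  1ℚ ℚ.+ ∣ x K ∣                ∎
  where
  open ℚ.≤-Reasoning
  rearrange : ∀ p q → p ≡ (p ℚ.- q) ℚ.+ q
  rearrange = S.solve 2 (λ p q → p S.:= (p S.:- q) S.:+ q) refl

*-rearrange : ∀ p q r s →
  p ℚ.* q ℚ.- r ℚ.* s ≡ p ℚ.* (q ℚ.- s) ℚ.+ s ℚ.* (p ℚ.- r)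
*-rearrange = S.solve 4 (λ p q r s →
  p S.:* q S.:- r S.:* s S.:= p S.:* (q S.:- s) S.:+ s S.:* (p S.:- r)) refl

quotient : ∀ D δ → 0ℚ ℚ.< D → 0ℚ ℚ.< δ → ∃ λ η → 0ℚ ℚ.< η × D ℚ.* η ≡ δ
quotient D δ 0<D 0<δ =
  D⁻¹ ℚ.* δ ,
  ℚ.positive⁻¹ (D⁻¹ ℚ.* δ) {{ℚ.pos*pos⇒pos D⁻¹ {{ℚ.1/pos⇒pos D}} δ {{ℚ.positive 0<δ}}}} ,
  trans (sym (ℚ.*-assoc D D⁻¹ δ))
    (trans (cong (ℚ._* δ) (ℚ.*-inverseʳ D)) (ℚ.*-identityˡ δ))
  where
  instance
    D-pos : ℚ.Positive D
    D-pos = ℚ.positive 0<D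
    D-nonZero : ℚ.NonZero D
    D-nonZero = ℚ.pos⇒nonZero D
  D⁻¹ : ℚ
  D⁻¹ = ℚ.1/ D

scale : ∀ {D η} → 0ℚ ℚ.< D → ∀ u v → ∣ u ∣ ℚ.≤ D → ∣ v ∣ ℚ.< η →
        ∣ u ℚ.* v ∣ ℚ.< D ℚ.* η
scale {D} {η} 0<D u v u≤D v<η = begin-strict
  ∣ u ℚ.* v ∣      ≡⟨ ℚ.∣p*q∣≡∣p∣*∣q∣ u v ⟩
  ∣ u ∣ ℚ.* ∣ v ∣  ≤⟨ ℚ.*-monoʳ-≤-nonNeg ∣ v ∣ {{ℚ.∣-∣-nonNeg v}} u≤D ⟩
  D ℚ.* ∣ v ∣      <⟨ ℚ.*-monoʳ-<-pos D {{ℚ.positive 0<D}} v<η ⟩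
  D ℚ.* η          ∎
  where open ℚ.≤-Reasoning

p≤p+q : ∀ p q → 0ℚ ℚ.< q → p ℚ.≤ p ℚ.+ q
p≤p+q p q 0<q =
  subst (ℚ._≤ p ℚ.+ q) (ℚ.+-identityʳ p) (ℚ.+-monoʳ-≤ p (ℚ.<⇒≤ 0<q))

q≤p+q : ∀ p q → 0ℚ ℚ.< p → q ℚ.≤ p ℚ.+ q
q≤p+q p q 0<p =
  subst (ℚ._≤ p ℚ.+ q) (ℚ.+-identityˡ q) (ℚ.+-monoˡ-≤ q (ℚ.<⇒≤ 0<p))

commonBound : ∀ x y → CauchySeq x → CauchySeq y →
  ∃ λ D → 0ℚ ℚ.< D × ∃ λ K → ∀ n → K ℕ.≤ n → ∣ x n ∣ ℚ.≤ D × ∣ y n ∣ ℚ.≤ D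
commonBound x y cx cy =
  let B , 0<B , K , bx = bounded x cx
      C , 0<C , L , by = bounded y cy
  in B ℚ.+ C , ℚ.+-mono-< {0ℚ} {B} {0ℚ} {C} 0<B 0<C , K ℕ.⊔ L , λ n h →
       ℚ.≤-trans (bx n (⊔-≤ˡ h)) (p≤p+q B C 0<C) ,
       ℚ.≤-trans (by n (⊔-≤ʳ {K} h)) (q≤p+q B C 0<B)

*-cauchy : ∀ x y → CauchySeq x → CauchySeq y → CauchySeq (λ n → x n ℚ.* y n)
*-cauchy x y cx cy δ 0<δ =
  let D , 0<D , J , b = commonBound x y cx cy
      η , 0<η , D*η   = quotient D (½ ℚ.* δ) 0<D (half-pos 0<δ)
      K , c           = cx η 0<η
      L , d           = cy η 0<η
  in J ℕ.⊔ (K ℕ.⊔ L) , λ m n h i → begin-strict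
    ∣ x m ℚ.* y m ℚ.- x n ℚ.* y n ∣
      ≡⟨ cong ∣_∣ (*-rearrange (x m) (y m) (x n) (y n)) ⟩
    ∣ x m ℚ.* (y m ℚ.- y n) ℚ.+ y n ℚ.* (x m ℚ.- x n) ∣
      ≤⟨ ℚ.∣p+q∣≤∣p∣+∣q∣ (x m ℚ.* (y m ℚ.- y n)) (y n ℚ.* (x m ℚ.- x n)) ⟩
    ∣ x m ℚ.* (y m ℚ.- y n) ∣ ℚ.+ ∣ y n ℚ.* (x m ℚ.- x n) ∣
      <⟨ ℚ.+-mono-<
           (scale 0<D (x m) (y m ℚ.- y n) (proj₁ (b m (⊔-≤ˡ h)))
             (d m n (⊔-≤ʳ {K} (⊔-≤ʳ {J} h)) (⊔-≤ʳ {K} (⊔-≤ʳ {J} i))))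
           (scale 0<D (y n) (x m ℚ.- x n) (proj₂ (b n (⊔-≤ˡ i)))
             (c m n (⊔-≤ˡ (⊔-≤ʳ {J} h)) (⊔-≤ˡ (⊔-≤ʳ {J} i)))) ⟩
    D ℚ.* η ℚ.+ D ℚ.* η
      ≡⟨ cong₂ ℚ._+_ D*η D*η ⟩
    ½ ℚ.* δ ℚ.+ ½ ℚ.* δ
      ≡⟨ halves δ ⟩
    δ ∎
  where open ℚ.≤-Reasoning

fromℚ : ℚ → ℝ
fromℚ p = real (λ _ → p) (const-cauchy p)

0ℝ 1ℝ : ℝ
0ℝ = fromℚ 0ℚ
1ℝ = fromℚ 1ℚ

infix  8 -ℝ_
infixl 7 _*ℝ_
infixl 6 _+ℝ_ _-ℝ_

_+ℝ_ : ℝ → ℝ → ℝ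
x +ℝ y = real (λ n → seq x n ℚ.+ seq y n) (+-cauchy (seq x) (seq y) (cauchy x) (cauchy y))

-ℝ_ : ℝ → ℝ
-ℝ x = real (λ n → ℚ.- seq x n) (neg-cauchy (seq x) (cauchy x))

_-ℝ_ : ℝ → ℝ → ℝ
x -ℝ y = x +ℝ (-ℝ y)

_*ℝ_ : ℝ → ℝ → ℝ
x *ℝ y = real (λ n → seq x n ℚ.* seq y n) (*-cauchy (seq x) (seq y) (cauchy x) (cauchy y))

record UnitInterval : Set where
  constructor point
  field
    value : ℝ
    0≤    : 0ℝ ≤ℝ value
    ≤1    : value ≤ℝ 1ℝ

open UnitInterval public

1ᴵ : UnitInterval
1ᴵ = point 1ℝ (λ δ 0<δ → 0 , λ _ _ → ℚ.<⇒≤ (ℚ.+-mono-≤-< (ℚ.nonNegative⁻¹ 1ℚ) 0<δ))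
              (λ δ 0<δ → 0 , λ _ _ → ℚ.+-monoʳ-≤ 1ℚ (ℚ.<⇒≤ 0<δ))

infix 5 sumOver
syntax sumOver xs (λ x → e) = ∑[ x ∈ xs ] e

sumOver : ∀ {A : Set} → List A → (A → ℝ) → ℝ
sumOver xs f = foldr (λ x s → f x +ℝ s) 0ℝ xs

------------------------------------------------------------------------
-- ℝ ∪ {+∞}, as the rounded, inhabited lower sets of rationals: the point
-- x is represented by the set of rationals strictly below it, and +∞ by
-- the set of all rationals.

record ℝ∞ : Set₁ where
  field
    Below     : ℚ → Set
    inhabited : ∃ Below
    lower     : ∀ {p q} → p ℚ.< q → Below q → Below p
    rounded   : ∀ {p} → Below p → ∃ λ q → p ℚ.< q × Below q

open ℝ∞ public

infix 4 _≤∞_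

_≤∞_ : ℝ∞ → ℝ∞ → Set
x ≤∞ y = ∀ q → Below x q → Below y q

partialSum : (ℕ → ℝ) → ℕ → ℝ
partialSum a zero    = 0ℝ
partialSum a (suc n) = partialSum a n +ℝ a n

-- The supremum of the partial sums; this is the sum of the series
-- a 0 + a 1 + … whenever its terms are nonnegative.

series : (ℕ → ℝ) → ℝ∞
series a = record
  { Below     = λ q → ∃ λ n → fromℚ q <ℝ partialSum a n
  ; inhabited = ℚ.- 1ℚ , 0 , 1ℚ , ℚ.positive⁻¹ 1ℚ , 0 , λ _ _ → ℚ.≤-refl
  ; lower     = λ p<q (n , δ , 0<δ , K , h) →
      n , δ , 0<δ , K , λ i K≤i → ℚ.≤-trans (ℚ.+-monoˡ-≤ δ (ℚ.<⇒≤ p<q)) (h i K≤i)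
  ; rounded   = λ {p} (n , δ , 0<δ , K , h) →
      p ℚ.+ ½ ℚ.* δ ,
      subst (ℚ._< p ℚ.+ ½ ℚ.* δ) (ℚ.+-identityʳ p) (ℚ.+-monoʳ-< p (half-pos 0<δ)) ,
      n , ½ ℚ.* δ , half-pos 0<δ , K , λ i K≤i →
        subst (ℚ._≤ seq (partialSum a n) i)
          (trans (cong (p ℚ.+_) (sym (halves δ)))
                 (sym (ℚ.+-assoc p (½ ℚ.* δ) (½ ℚ.* δ))))
          (h i K≤i)
  }

------------------------------------------------------------------------
-- Finitely supported functions Λ → ℝ.  The support list may contain
-- points of mass zero.

record FinSupp : Set where
  field
    support   : List Term
    unique    : Unique support
    mass      : Term → ℝ
    vanishing : ∀ {N} → N ∉ support → mass N ≃ℝ 0ℝ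

open FinSupp public

total : FinSupp → ℝ
total ρ = ∑[ N ∈ support ρ ] mass ρ N

δ[_] : Term → Term → ℝ
δ[ M ] N with M ≟ N
... | yes _ = 1ℝ
... | no  _ = 0ℝ

≐0⇒≃0 : ∀ x → (∀ n → seq x n ≡ 0ℚ) → x ≃ℝ 0ℝ
≐0⇒≃0 x x≐0 δ 0<δ =
  0 , λ n _ → subst (λ p → ∣ p ℚ.- 0ℚ ∣ ℚ.< δ) (sym (x≐0 n)) 0<δ

δ≐0 : ∀ {M N} → M ≢ N → ∀ n → seq (δ[ M ] N) n ≡ 0ℚ
δ≐0 {M} {N} M≢N n with M ≟ N
... | yes M≡N = ⊥-elim (M≢N M≡N)
... | no  _   = refl

sum≐0 : ∀ {A : Set} (xs : List A) f →
        (∀ {x} → x ∈ xs → ∀ n → seq (f x) n ≡ 0ℚ) →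
        ∀ n → seq (sumOver xs f) n ≡ 0ℚ
sum≐0 []       f f≐0 n = refl
sum≐0 (x ∷ xs) f f≐0 n =
  cong₂ ℚ._+_ (f≐0 (here refl) n) (sum≐0 xs f (f≐0 ∘ there) n)

dirac : Term → FinSupp
dirac M = record
  { support   = M ∷ []
  ; unique    = [] ∷ []
  ; mass      = δ[ M ]
  ; vanishing = λ {N} N∉ → ≐0⇒≃0 (δ[ M ] N) (δ≐0 λ M≡N → N∉ (here (sym M≡N)))
  }

------------------------------------------------------------------------

P : UnitInterval → ∀ M → Reducible M → Term → ℝ
P ε M r N = value ε *ℝ δ[ LO M r ] N +ℝ (1ℝ -ℝ value ε) *ℝ δ[ RI M r ] N

ℙ : UnitInterval → Term → Term → ℝ
ℙ ε M N with reducible? M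
... | yes r = P ε M r N
... | no  _ = 0ℝ

successors : Term → List Term
successors M with reducible? M
... | yes r = LO M r ∷ RI M r ∷ []
... | no  _ = []

ℙ≐0 : ∀ ε {M N} → N ∉ successors M → ∀ n → seq (ℙ ε M N) n ≡ 0ℚ
ℙ≐0 ε {M} {N} N∉ n with reducible? M
... | no  _ = refl
... | yes r = cong₂ ℚ._+_
  (trans (cong (seq (value ε) n ℚ.*_) (δ≐0 (λ e → N∉ (here (sym e))) n))
         (ℚ.*-zeroʳ (seq (value ε) n)))
  (trans (cong (seq (1ℝ -ℝ value ε) n ℚ.*_) (δ≐0 (λ e → N∉ (there (here (sym e)))) n))
         (ℚ.*-zeroʳ (seq (1ℝ -ℝ value ε) n)))

stepMass : UnitInterval → FinSupp → Term → ℝ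
stepMass ε ρ N = ∑[ L ∈ support ρ ] mass ρ L *ℝ ℙ ε L N

stepSupport : FinSupp → List Term
stepSupport ρ = deduplicate _≟_ (concatMap successors (support ρ))

∈-stepSupport : ∀ ρ {L N} → L ∈ support ρ → N ∈ successors L → N ∈ stepSupport ρ
∈-stepSupport ρ L∈ N∈ = ∈-deduplicate⁺ _≟_
  (∈-concatMap⁺ successors (Any.map (λ { refl → N∈ }) L∈))

stepMass≐0 : ∀ ε ρ {N} → N ∉ stepSupport ρ → ∀ n → seq (stepMass ε ρ N) n ≡ 0ℚ
stepMass≐0 ε ρ {N} N∉ =
  sum≐0 (support ρ) (λ L → mass ρ L *ℝ ℙ ε L N) λ {L} L∈ n →
    trans (cong (seq (mass ρ L) n ℚ.*_) (ℙ≐0 ε {L} {N} (N∉ ∘ ∈-stepSupport ρ L∈) n))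
          (ℚ.*-zeroʳ (seq (mass ρ L) n))

step : UnitInterval → FinSupp → FinSupp
step ε ρ = record
  { support   = stepSupport ρ
  ; unique    = UniqueDec.deduplicate-! _≟_ (concatMap successors (support ρ))
  ; mass      = stepMass ε ρ
  ; vanishing = λ {N} N∉ → ≐0⇒≃0 (stepMass ε ρ N) (stepMass≐0 ε ρ N∉)
  }

computation : UnitInterval → Term → ℕ → FinSupp
computation ε M zero    = dirac M
computation ε M (suc i) = step ε (computation ε M i)

ExpLen : Term → UnitInterval → ℝ∞
ExpLen M ε = series λ i → total (computation ε M (suc i))

-- For affine terms, if the leftmost-outermost strategy makes at least n + 1
-- steps from M, then it makes at least n steps from every one-step reduct of
-- M: a redex S ≠ LO(M) has at most one residual after LO(M) is fired, while
-- LO(M) stays leftmost-outermost after S is fired, and the resulting diamond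
-- allows an induction on n.  So while the LO strategy is running, no mixture
-- of LO and RI reaches a normal form, and |ρᵢ| is exactly 1 for both
-- strategies; once it has stopped, |ρᵢ| is 0 for ε = 1.  A partial sum for
-- ε = 1 is therefore equal, as a sequence of rationals, to a partial sum for
-- any other ε.

module Submission where

open import Defs

open import Data.List.Base using (List; []; _∷_; foldr; concatMap)
open import Data.List.Extrema.Nat using (f[argmin]≤f[xs])
open import Data.List.Membership.Propositional using (_∈_; find)
open import Data.List.Membership.Propositional.Properties
  using (∈-deduplicate⁻; ∈-concatMap⁻)
open import Data.List.Relation.Unary.All as All using ()
open import Data.List.Relation.Unary.AllPairs using ([]; _∷_)
open import Data.List.Relation.Unary.Any using (here; there)
open import Data.List.Relation.Unary.Unique.Propositional using (Unique)
open import Data.Nat.Base as ℕ using (ℕ; zero; suc; z≤n; s≤s)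
import Data.Nat.Properties as ℕ
import Data.Nat.Solver as ℕ-Solver
open import Data.Product.Base using (∃; _×_; _,_; proj₁; proj₂)
open import Data.Rational.Base as ℚ using (ℚ; 0ℚ; 1ℚ)
import Data.Rational.Properties as ℚ
open import Data.Sum.Base as Sum using (_⊎_; inj₁; inj₂)
open import Function.Base using (_∘_)
open import Relation.Binary.PropositionalEquality
  using (_≡_; _≢_; _≗_; refl; sym; trans; cong; cong₂; subst; subst₂; module ≡-Reasoning)
open import Relation.Nullary.Decidable using (yes; no)
open import Relation.Nullary.Negation using (¬_; contradiction)

-- Substitution

exts-cong : ∀ {σ τ} → σ ≗ τ → exts σ ≗ exts τ
exts-cong eq zero    = refl
exts-cong eq (suc x) = cong (rename suc) (eq x)

substitute-cong : ∀ {σ τ} → σ ≗ τ → substitute σ ≗ substitute τ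
substitute-cong eq (var x) = eq x
substitute-cong eq (M · N) = cong₂ _·_ (substitute-cong eq M) (substitute-cong eq N)
substitute-cong eq (ƛ M)   = cong ƛ_ (substitute-cong (exts-cong eq) M)

exts-var : ∀ {σ} f → σ ≗ var ∘ f → exts σ ≗ var ∘ ext f
exts-var f eq zero    = refl
exts-var f eq (suc x) = cong (rename suc) (eq x)

rename≗substitute : ∀ f → rename f ≗ substitute (var ∘ f)
rename≗substitute f (var x) = refl
rename≗substitute f (M · N) = cong₂ _·_ (rename≗substitute f M) (rename≗substitute f N)
rename≗substitute f (ƛ M)   = cong ƛ_ (trans (rename≗substitute (ext f) M)
  (substitute-cong (sym ∘ exts-var f (λ _ → refl)) M))

substitute-rename : ∀ σ f M → substitute σ (rename f M) ≡ substitute (σ ∘ f) M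
substitute-rename σ f (var x) = refl
substitute-rename σ f (M · N) = cong₂ _·_ (substitute-rename σ f M) (substitute-rename σ f N)
substitute-rename σ f (ƛ M)   = cong ƛ_ (trans (substitute-rename (exts σ) (ext f) M)
  (substitute-cong (λ { zero → refl ; (suc _) → refl }) M))

rename-rename : ∀ f g M → rename f (rename g M) ≡ rename (f ∘ g) M
rename-rename f g M = trans (rename≗substitute f (rename g M))
  (trans (substitute-rename (var ∘ f) g M) (sym (rename≗substitute (f ∘ g) M)))

rename-substitute : ∀ f σ M → rename f (substitute σ M) ≡ substitute (rename f ∘ σ) M
rename-substitute f σ (var x) = refl
rename-substitute f σ (M · N) = cong₂ _·_ (rename-substitute f σ M) (rename-substitute f σ N)
rename-substitute f σ (ƛ M)   = cong ƛ_ (trans (rename-substitute (ext f) (exts σ) M)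
  (substitute-cong commute M))
  where
  commute : rename (ext f) ∘ exts σ ≗ exts (rename f ∘ σ)
  commute zero    = refl
  commute (suc x) = trans (rename-rename (ext f) suc (σ x)) (sym (rename-rename suc f (σ x)))

substitute-substitute : ∀ σ τ M → substitute σ (substitute τ M) ≡ substitute (substitute σ ∘ τ) M
substitute-substitute σ τ (var x) = refl
substitute-substitute σ τ (M · N) =
  cong₂ _·_ (substitute-substitute σ τ M) (substitute-substitute σ τ N)
substitute-substitute σ τ (ƛ M)   = cong ƛ_ (trans (substitute-substitute (exts σ) (exts τ) M)
  (substitute-cong commute M))
  where
  commute : substitute (exts σ) ∘ exts τ ≗ exts (substitute σ ∘ τ)
  commute zero    = refl
  commute (suc x) = trans (substitute-rename (exts σ) suc (τ x)) (sym (rename-substitute suc σ (τ x)))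

substitute-var : ∀ {σ} → σ ≗ var → ∀ M → substitute σ M ≡ M
substitute-var eq (var x) = eq x
substitute-var eq (M · N) = cong₂ _·_ (substitute-var eq M) (substitute-var eq N)
substitute-var eq (ƛ M)   = cong ƛ_ (substitute-var exts-eq M)
  where
  exts-eq : exts _ ≗ var
  exts-eq zero    = refl
  exts-eq (suc x) = cong (rename suc) (eq x)

-- Once each side is fused into a single substitution, it remains to see that `substitute σ N /0`
-- undoes the weakening that `exts` put on `σ x`.
substitute-[] : ∀ σ M N → substitute (exts σ) M [ substitute σ N ] ≡ substitute σ (M [ N ])
substitute-[] σ M N = trans (substitute-substitute (substitute σ N /0) (exts σ) M)
  (trans (substitute-cong commute M) (sym (substitute-substitute σ (N /0) M)))
  where
  commute : substitute (substitute σ N /0) ∘ exts σ ≗ substitute σ ∘ (N /0)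
  commute zero    = refl
  commute (suc x) = trans (substitute-rename (substitute σ N /0) suc (σ x))
                          (substitute-var (λ _ → refl) (σ x))

substitute-⟶β : ∀ σ {M N} → M ⟶β N → substitute σ M ⟶β substitute σ N
substitute-⟶β σ (R , refl) = residual σ R
  where
  residual : ∀ σ {M} (R : Redex M) → substitute σ M ⟶β substitute σ (fire R)
  residual σ (root {M} {N}) = root , substitute-[] σ M N
  residual σ (body R) with residual (exts σ) R
  ... | R′ , eq = body R′ , cong ƛ_ eq
  residual σ (left {N = N} R) with residual σ R
  ... | R′ , eq = left R′ , cong (_· substitute σ N) eq
  residual σ (right {M = M} R) with residual σ R
  ... | R′ , eq = right R′ , cong (substitute σ M ·_) eq

rename-⟶β : ∀ f {M N} → M ⟶β N → rename f M ⟶β rename f N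
rename-⟶β f {M} {N} M⟶N = subst₂ _⟶β_
  (sym (rename≗substitute f M)) (sym (rename≗substitute f N)) (substitute-⟶β (var ∘ f) M⟶N)

-- Affine terms

occurrences-suc : ∀ x y → occurrences (suc x) (var (suc y)) ≡ occurrences x (var y)
occurrences-suc x y with x ℕ.≟ y | suc x ℕ.≟ suc y
... | yes _   | yes _  = refl
... | yes x≡y | no ≢   = contradiction (cong suc x≡y) ≢
... | no x≢y  | yes eq = contradiction (ℕ.suc-injective eq) x≢y
... | no _    | no _   = refl

-- Will relate `N /0` to `fire S /0`, the substitutions before and after a step inside the argument
-- of a redex.
AgreeOff : ℕ → (ℕ → Term) → (ℕ → Term) → Set
AgreeOff x σ τ = ∀ y → x ≢ y → σ y ≡ τ y

exts-agree : ∀ {x σ τ} → AgreeOff x σ τ → AgreeOff (suc x) (exts σ) (exts τ)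
exts-agree σ≈τ zero    x≢y = refl
exts-agree σ≈τ (suc y) x≢y = cong (rename suc) (σ≈τ y (x≢y ∘ cong suc))

substitute-fresh : ∀ {x σ τ} → AgreeOff x σ τ → ∀ M → occurrences x M ≡ 0 →
                   substitute σ M ≡ substitute τ M
substitute-fresh {x} σ≈τ (var y) eq with x ℕ.≟ y
... | no x≢y = σ≈τ y x≢y
substitute-fresh {x} σ≈τ (M · N) eq = cong₂ _·_
  (substitute-fresh σ≈τ M (ℕ.m+n≡0⇒m≡0 (occurrences x M) eq))
  (substitute-fresh σ≈τ N (ℕ.m+n≡0⇒n≡0 (occurrences x M) eq))
substitute-fresh σ≈τ (ƛ M) eq = cong ƛ_ (substitute-fresh (exts-agree σ≈τ) M eq)

m+n≡1 : ∀ m {n} → m ℕ.+ n ≡ 1 → (m ≡ 0 × n ≡ 1) ⊎ (m ≡ 1 × n ≡ 0)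
m+n≡1 zero          eq = inj₁ (refl , eq)
m+n≡1 (suc zero)    eq = inj₂ (refl , ℕ.suc-injective eq)

-- At every application the single occurrence of `x` lies on one side; the step is made there, and
-- `substitute-fresh` settles the other side. A second occurrence would call for a second step.
substitute-linear : ∀ {x σ τ} → AgreeOff x σ τ → σ x ⟶β τ x → ∀ M → occurrences x M ≡ 1 →
                    substitute σ M ⟶β substitute τ M
substitute-linear {x} σ≈τ σ⟶τ (var y) eq with x ℕ.≟ y
... | yes refl = σ⟶τ
substitute-linear {x} {σ} {τ} σ≈τ σ⟶τ (M · N) eq with m+n≡1 (occurrences x M) eq
... | inj₁ (m≡0 , n≡1) with substitute-linear σ≈τ σ⟶τ N n≡1
...   | R , fires = right R , cong₂ _·_ (substitute-fresh σ≈τ M m≡0) fires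
substitute-linear {x} {σ} {τ} σ≈τ σ⟶τ (M · N) eq | inj₂ (m≡1 , n≡0)
  with substitute-linear σ≈τ σ⟶τ M m≡1
...   | R , fires = left R , cong₂ _·_ fires (substitute-fresh σ≈τ N n≡0)
substitute-linear σ≈τ σ⟶τ (ƛ M) eq
  with substitute-linear (exts-agree σ≈τ) (rename-⟶β suc σ⟶τ) M eq
... | R , fires = body R , cong ƛ_ fires

-- The factor `b` serves two uses: `b = 1` shows that weakening creates no occurrences, and `b = 0`
-- that index 0 is absent from a weakened term.
occurrences-rename : ∀ b {f z x} →
  (∀ y → occurrences z (var (f y)) ℕ.≤ occurrences x (var y) ℕ.* b) →
  ∀ M → occurrences z (rename f M) ℕ.≤ occurrences x M ℕ.* b
occurrences-rename b bound (var y) = bound y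
occurrences-rename b {f} {z} {x} bound (M · N) = begin
  occurrences z (rename f M) ℕ.+ occurrences z (rename f N)
    ≤⟨ ℕ.+-mono-≤ (occurrences-rename b bound M) (occurrences-rename b bound N) ⟩
  occurrences x M ℕ.* b ℕ.+ occurrences x N ℕ.* b
    ≡⟨ ℕ.*-distribʳ-+ b (occurrences x M) (occurrences x N) ⟨
  (occurrences x M ℕ.+ occurrences x N) ℕ.* b ∎
  where open ℕ.≤-Reasoning
occurrences-rename b {f} {z} {x} bound (ƛ M) = occurrences-rename b bound′ M
  where
  bound′ : ∀ y → occurrences (suc z) (var (ext f y)) ℕ.≤ occurrences (suc x) (var y) ℕ.* b
  bound′ zero    = z≤n
  bound′ (suc y) = subst₂ (λ m n → m ℕ.≤ n ℕ.* b)
    (sym (occurrences-suc z (f y))) (sym (occurrences-suc x y)) (bound y)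

occurrences-weaken : ∀ z M → occurrences (suc z) (rename suc M) ℕ.≤ occurrences z M
occurrences-weaken z M = subst (occurrences (suc z) (rename suc M) ℕ.≤_)
  (ℕ.*-identityʳ (occurrences z M))
  (occurrences-rename 1 (λ y → ℕ.≤-reflexive
    (trans (occurrences-suc z y) (sym (ℕ.*-identityʳ _)))) M)

zero-fresh-weaken : ∀ M → occurrences 0 (rename suc M) ℕ.≤ 0
zero-fresh-weaken M = subst (occurrences 0 (rename suc M) ℕ.≤_)
  (ℕ.*-zeroʳ (occurrences 0 M)) (occurrences-rename 0 (λ _ → z≤n) M)

-- For a contraction M [ N ], u is the contracted variable and b counts the
-- occurrences of z in N; b = 0 and u = x covers passing under a binder.
occurrences-substitute : ∀ b {σ z x u} →
  (∀ y → occurrences z (σ y) ℕ.≤ occurrences x (var y) ℕ.+ occurrences u (var y) ℕ.* b) →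
  ∀ M → occurrences z (substitute σ M) ℕ.≤ occurrences x M ℕ.+ occurrences u M ℕ.* b
occurrences-substitute b bound (var y) = bound y
occurrences-substitute b {σ} {z} {x} {u} bound (M · N) = begin
  occurrences z (substitute σ M) ℕ.+ occurrences z (substitute σ N)
    ≤⟨ ℕ.+-mono-≤ (occurrences-substitute b bound M) (occurrences-substitute b bound N) ⟩
  (occurrences x M ℕ.+ occurrences u M ℕ.* b) ℕ.+ (occurrences x N ℕ.+ occurrences u N ℕ.* b)
    ≡⟨ solve 5 (λ k l m n b → (k :+ l :* b) :+ (m :+ n :* b) := (k :+ m) :+ (l :+ n) :* b)
         refl (occurrences x M) (occurrences u M) (occurrences x N) (occurrences u N) b ⟩
  (occurrences x M ℕ.+ occurrences x N) ℕ.+ (occurrences u M ℕ.+ occurrences u N) ℕ.* b ∎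
  where
  open ℕ.≤-Reasoning
  open ℕ-Solver.+-*-Solver
occurrences-substitute b {σ} {z} {x} {u} bound (ƛ M) = occurrences-substitute b bound′ M
  where
  bound′ : ∀ y → occurrences (suc z) (exts σ y) ℕ.≤
                 occurrences (suc x) (var y) ℕ.+ occurrences (suc u) (var y) ℕ.* b
  bound′ zero    = z≤n
  bound′ (suc y) = ℕ.≤-trans (occurrences-weaken z (σ y))
    (subst₂ (λ m n → occurrences z (σ y) ℕ.≤ m ℕ.+ n ℕ.* b)
      (sym (occurrences-suc x y)) (sym (occurrences-suc u y)) (bound y))

-- `exts σ` fixes index 0 and sends every other index to a weakened term, from which 0 is absent.
occurrences-exts : ∀ σ M → occurrences 0 (substitute (exts σ) M) ℕ.≤ occurrences 0 M
occurrences-exts σ M = subst (occurrences 0 (substitute (exts σ) M) ℕ.≤_)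
  (trans (cong (occurrences 0 M ℕ.+_) (ℕ.*-zeroʳ (occurrences 0 M)))
         (ℕ.+-identityʳ (occurrences 0 M)))
  (occurrences-substitute 0 {u = 0} bound M)
  where
  bound : ∀ y → occurrences 0 (exts σ y) ℕ.≤ occurrences 0 (var y) ℕ.+ occurrences 0 (var y) ℕ.* 0
  bound zero    = s≤s z≤n
  bound (suc y) = zero-fresh-weaken (σ y)

-- Closure of affine terms under reduction

affine-var : ∀ x → Affine (var x)
affine-var x N ()

affine-ƛ : ∀ {M} → occurrences 0 M ℕ.≤ 1 → Affine M → Affine (ƛ M)
affine-ƛ occ≤1 aff N self       = occ≤1
affine-ƛ occ≤1 aff N (body N⊑M) = aff N N⊑M

affine-· : ∀ {M N} → Affine M → Affine N → Affine (M · N)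
affine-· affM affN L (left  L⊑M) = affM L L⊑M
affine-· affM affN L (right L⊑N) = affN L L⊑N

affine-body : ∀ {M} → Affine (ƛ M) → Affine M
affine-body aff N = aff N ∘ body

affine-left : ∀ {M N} → Affine (M · N) → Affine M
affine-left aff L = aff L ∘ left

affine-right : ∀ {M N} → Affine (M · N) → Affine N
affine-right aff L = aff L ∘ right

affine-rename : ∀ f M → Affine M → Affine (rename f M)
affine-rename f (var x) aff = affine-var (f x)
affine-rename f (M · N) aff =
  affine-· (affine-rename f M (affine-left aff)) (affine-rename f N (affine-right aff))
affine-rename f (ƛ M)   aff = affine-ƛ
  (ℕ.≤-trans
    (subst (λ K → occurrences 0 K ℕ.≤ occurrences 0 M)
      (sym (trans (rename≗substitute (ext f) M)
                  (substitute-cong (sym ∘ exts-var f (λ _ → refl)) M)))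
      (occurrences-exts (var ∘ f) M))
    (aff M self))
  (affine-rename (ext f) M (affine-body aff))

affine-substitute : ∀ {σ} → (∀ x → Affine (σ x)) → ∀ M → Affine M → Affine (substitute σ M)
affine-substitute affσ (var x) aff = affσ x
affine-substitute affσ (M · N) aff = affine-·
  (affine-substitute affσ M (affine-left aff)) (affine-substitute affσ N (affine-right aff))
affine-substitute {σ} affσ (ƛ M) aff = affine-ƛ
  (ℕ.≤-trans (occurrences-exts σ M) (aff M self))
  (affine-substitute aff-exts M (affine-body aff))
  where
  aff-exts : ∀ x → Affine (exts σ x)
  aff-exts zero    = affine-var 0
  aff-exts (suc x) = affine-rename suc (σ x) (affσ x)

-- A contraction puts `N` where the bound variable stood, hence at most once by affinity: arguments
-- may be erased but are never copied.
occurrences-fire : ∀ {M} → Affine M → (R : Redex M) → ∀ x → occurrences x (fire R) ℕ.≤ occurrences x M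
occurrences-fire aff (root {M} {N}) x = begin
  occurrences x (M [ N ])
    ≤⟨ occurrences-substitute (occurrences x N) bound M ⟩
  occurrences (suc x) M ℕ.+ occurrences 0 M ℕ.* occurrences x N
    ≤⟨ ℕ.+-monoʳ-≤ (occurrences (suc x) M)
         (ℕ.*-monoˡ-≤ (occurrences x N) (aff M (left self))) ⟩
  occurrences (suc x) M ℕ.+ 1 ℕ.* occurrences x N
    ≡⟨ cong (occurrences (suc x) M ℕ.+_) (ℕ.*-identityˡ (occurrences x N)) ⟩
  occurrences (suc x) M ℕ.+ occurrences x N ∎
  where
  open ℕ.≤-Reasoning
  bound : ∀ y → occurrences x ((N /0) y) ℕ.≤
                occurrences (suc x) (var y) ℕ.+ occurrences 0 (var y) ℕ.* occurrences x N
  bound zero    = ℕ.≤-reflexive (sym (ℕ.*-identityˡ (occurrences x N)))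
  bound (suc y) = ℕ.≤-reflexive (trans (sym (occurrences-suc x y)) (sym (ℕ.+-identityʳ _)))
occurrences-fire aff (body R) x = occurrences-fire (affine-body aff) R (suc x)
occurrences-fire aff (left {N = N} R) x =
  ℕ.+-monoˡ-≤ (occurrences x N) (occurrences-fire (affine-left aff) R x)
occurrences-fire aff (right {M = M} R) x =
  ℕ.+-monoʳ-≤ (occurrences x M) (occurrences-fire (affine-right aff) R x)

affine-fire : ∀ {M} → Affine M → (R : Redex M) → Affine (fire R)
affine-fire aff (root {M} {N}) = affine-substitute aff-/0 M (affine-body (affine-left aff))
  where
  aff-/0 : ∀ x → Affine ((N /0) x)
  aff-/0 zero    = affine-right aff
  aff-/0 (suc x) = affine-var x
affine-fire aff (body {M} R) = affine-ƛ
  (ℕ.≤-trans (occurrences-fire (affine-body aff) R 0) (aff M self))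
  (affine-fire (affine-body aff) R)
affine-fire aff (left R)  = affine-· (affine-fire (affine-left aff) R) (affine-right aff)
affine-fire aff (right R) = affine-· (affine-left aff) (affine-fire (affine-right aff) R)

-- Leftmost-outermost reduction

data NotAbs : Term → Set where
  var : ∀ {x} → NotAbs (var x)
  app : ∀ {M N} → NotAbs (M · N)

-- A structural form of having the least starting symbol. In an application the root redex starts
-- first, then the redexes of the function, then those of the argument; the premises exclude earlier
-- candidates.
data IsLO : ∀ {M} → Redex M → Set where
  root  : ∀ {M N} → IsLO (root {M} {N})
  body  : ∀ {M} {R : Redex M} → IsLO R → IsLO (body R)
  left  : ∀ {M N} {R : Redex M} → NotAbs M → IsLO R → IsLO (left {N = N} R)
  right : ∀ {M N} {R : Redex N} → NotAbs M → ¬ Redex M → IsLO R → IsLO (right {M = M} R)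

start<writtenLength : ∀ {M} (R : Redex M) → start R ℕ.< writtenLength M
start<writtenLength root     = s≤s z≤n
start<writtenLength (body R) = ℕ.+-monoʳ-< 3 (start<writtenLength R)
start<writtenLength (left {M} {N} R) = s≤s (begin-strict
  start R                                       <⟨ start<writtenLength R ⟩
  writtenLength M                               ≤⟨ ℕ.m≤m+n _ _ ⟩
  writtenLength M ℕ.+ writtenLength N           ≤⟨ ℕ.m≤m+n _ 1 ⟩
  writtenLength M ℕ.+ writtenLength N ℕ.+ 1     ∎)
  where open ℕ.≤-Reasoning hiding (start)
start<writtenLength (right {M} {N} R) = s≤s (begin-strict
  writtenLength M ℕ.+ start R                   <⟨ ℕ.+-monoʳ-< (writtenLength M) (start<writtenLength R) ⟩
  writtenLength M ℕ.+ writtenLength N           ≤⟨ ℕ.m≤m+n _ 1 ⟩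
  writtenLength M ℕ.+ writtenLength N ℕ.+ 1     ∎)
  where open ℕ.≤-Reasoning hiding (start)

-- A violated premise of `IsLO` would exhibit an earlier redex: an abstraction in function position
-- makes the root a redex, starting at 0, and a redex of the function starts before any redex of the
-- argument.
minimal⇒IsLO : ∀ {M} (R : Redex M) → (∀ (R′ : Redex M) → start R ℕ.≤ start R′) → IsLO R
minimal⇒IsLO root     min = root
minimal⇒IsLO (body R) min = body (minimal⇒IsLO R λ R′ → ℕ.+-cancelˡ-≤ 3 _ _ (min (body R′)))
minimal⇒IsLO (left {M} R) min =
  left (notAbs M R min) (minimal⇒IsLO R λ R′ → ℕ.≤-pred (min (left R′)))
  where
  notAbs : ∀ M {N} (R : Redex M) → (∀ (R′ : Redex (M · N)) → start (left {N = N} R) ℕ.≤ start R′) → NotAbs M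
  notAbs (_ · _) R min = app
  notAbs (ƛ _)   R min = contradiction (min root) λ ()
minimal⇒IsLO (right {M} R) min =
  right (notAbs M R min)
    (λ R′ → ℕ.<⇒≱ (start<writtenLength R′)
      (ℕ.≤-trans (ℕ.m≤m+n (writtenLength M) (start R)) (ℕ.≤-pred (min (left R′)))))
    (minimal⇒IsLO R λ R′ → ℕ.+-cancelˡ-≤ (1 ℕ.+ writtenLength M) _ _ (min (right R′)))
  where
  notAbs : ∀ M {N} (R : Redex N) → (∀ (R′ : Redex (M · N)) → start (right {M = M} R) ℕ.≤ start R′) → NotAbs M
  notAbs (var _) R min = var
  notAbs (_ · _) R min = app
  notAbs (ƛ _)   R min = contradiction (min root) λ ()

leftmost-IsLO : ∀ M r → IsLO (leftmost M r)
leftmost-IsLO M r@(_ , R , _) = minimal⇒IsLO (leftmost M r) λ R′ →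
  All.lookup (f[argmin]≤f[xs] {f = start} R (redexes M)) (∈-redexes R′)

-- Only contracting its root can turn a non-abstraction into an abstraction, and a root redex is the
-- leftmost-outermost one. So the `NotAbs` premise of `IsLO` survives every other step.
fire-NotAbs : ∀ {M} {R S : Redex M} → IsLO R → NotAbs M → R ≡ S ⊎ NotAbs (fire S)
fire-NotAbs {S = left _}  _    app = inj₂ app
fire-NotAbs {S = right _} _    app = inj₂ app
fire-NotAbs {S = root}    root app = inj₁ refl
fire-NotAbs {S = root}    (left () _) app
fire-NotAbs {S = root}    (right () _ _) app

-- `R′` is the residual of `R`. The final disjunction concerns `S`: firing `R` either erases it or
-- leaves one residual, whose contraction closes the diamond.
LO-diamond : ∀ {M} → Affine M → {R : Redex M} → IsLO R → (S : Redex M) →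
  R ≡ S ⊎ ∃ λ (R′ : Redex (fire S)) → IsLO R′ × (fire R ≡ fire R′ ⊎ fire R ⟶β fire R′)
LO-diamond aff root root = inj₁ refl
-- `S` lies in the body of the abstraction, and its residual is its instance under `N /0`.
LO-diamond aff (root {M} {N}) (left (body S)) =
  inj₂ (root , root , inj₂ (substitute-⟶β (N /0) (S , refl)))
LO-diamond aff (root {M} {N}) (right S) = inj₂ (root , root , residuals)
  where
  agree : AgreeOff 0 (N /0) (fire S /0)
  agree zero    0≢0 = contradiction refl 0≢0
  agree (suc y) _   = refl

  residuals : M [ N ] ≡ M [ fire S ] ⊎ M [ N ] ⟶β M [ fire S ]
  residuals with ℕ.m≤n⇒m<n∨m≡n (aff M (left self))
  -- The bound variable is absent, so the argument is erased and `S` with it.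
  ... | inj₁ (s≤s occ≤0) = inj₁ (substitute-fresh agree M (ℕ.n≤0⇒n≡0 occ≤0))
  ... | inj₂ occ≡1       = inj₂ (substitute-linear agree (S , refl) M occ≡1)
LO-diamond aff (body loR) (body S) with LO-diamond (affine-body aff) loR S
... | inj₁ refl                          = inj₁ refl
... | inj₂ (R′ , lo′ , inj₁ eq)          = inj₂ (body R′ , body lo′ , inj₁ (cong ƛ_ eq))
... | inj₂ (R′ , lo′ , inj₂ (S′ , eq))   = inj₂ (body R′ , body lo′ , inj₂ (body S′ , cong ƛ_ eq))
LO-diamond aff (left () _) root
LO-diamond aff (left {N = N} notAbs loR) (left S)
  with fire-NotAbs {S = S} loR notAbs | LO-diamond (affine-left aff) loR S
... | inj₁ refl    | _         = inj₁ refl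
... | _            | inj₁ refl = inj₁ refl
... | inj₂ notAbs′ | inj₂ (R′ , lo′ , inj₁ eq) =
  inj₂ (left R′ , left notAbs′ lo′ , inj₁ (cong (_· N) eq))
... | inj₂ notAbs′ | inj₂ (R′ , lo′ , inj₂ (S′ , eq)) =
  inj₂ (left R′ , left notAbs′ lo′ , inj₂ (left S′ , cong (_· N) eq))
-- Disjoint redexes: each survives the firing of the other unchanged.
LO-diamond aff (left {R = R} notAbs loR) (right S) =
  inj₂ (left R , left notAbs loR , inj₂ (right S , refl))
LO-diamond aff (right () _ _) root
LO-diamond aff (right _ normal _) (left S) = contradiction S normal
LO-diamond aff (right {M} notAbs normal loR) (right S) with LO-diamond (affine-right aff) loR S
... | inj₁ refl = inj₁ refl
... | inj₂ (R′ , lo′ , inj₁ eq) =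
  inj₂ (right R′ , right notAbs normal lo′ , inj₁ (cong (M ·_) eq))
... | inj₂ (R′ , lo′ , inj₂ (S′ , eq)) =
  inj₂ (right R′ , right notAbs normal lo′ , inj₂ (right S′ , cong (M ·_) eq))

-- Counting leftmost-outermost steps

data LOSteps : ℕ → Term → Term → Set where
  []  : ∀ {M} → LOSteps 0 M M
  _∷_ : ∀ {n M N} {R : Redex M} → IsLO R → LOSteps n (fire R) N → LOSteps (suc n) M N

infixl 5 _∷ʳ_

_∷ʳ_ : ∀ {n M N} {R : Redex N} → LOSteps n M N → IsLO R → LOSteps (suc n) M (fire R)
[]         ∷ʳ lo = lo ∷ []
(lo′ ∷ ls) ∷ʳ lo = lo′ ∷ (ls ∷ʳ lo)

LOSteps-init : ∀ {n M N} → LOSteps (suc n) M N → ∃ (LOSteps n M)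
LOSteps-init {zero}  (lo ∷ ls) = _ , []
LOSteps-init {suc n} (lo ∷ ls) = _ , lo ∷ proj₂ (LOSteps-init ls)

LOSteps-cons : ∀ {n M} {R : Redex M} → IsLO R → ∃ (LOSteps n (fire R)) → ∃ (LOSteps (suc n) M)
LOSteps-cons lo (_ , ls) = _ , lo ∷ ls

LOSteps-fire : ∀ n {M N} → Affine M → LOSteps (suc n) M N → (S : Redex M) → ∃ (LOSteps n (fire S))
LOSteps-fire zero    aff _         S = _ , []
LOSteps-fire (suc n) aff (_∷_ {R = R} lo ls) S with LO-diamond aff lo S
... | inj₁ refl = _ , ls
-- `S` is erased, so the run from `fire R` is also one from `fire R′`; its last step is dropped to
-- make up for `R′` added in front.
... | inj₂ (R′ , lo′ , inj₁ eq) =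
  LOSteps-cons lo′ (subst (λ L → ∃ (LOSteps n L)) eq (LOSteps-init ls))
-- The induction hypothesis charges one step to `S′`, and `R′` in front restores the count.
... | inj₂ (R′ , lo′ , inj₂ (S′ , eq)) =
  LOSteps-cons lo′ (subst (λ L → ∃ (LOSteps n L)) eq (LOSteps-fire n (affine-fire aff R) ls S′))

-- Finite sums of rationals

sum : ∀ {A : Set} → List A → (A → ℚ) → ℚ
sum xs f = foldr (λ x s → f x ℚ.+ s) 0ℚ xs

module _ {A : Set} where

  -- Real addition is termwise, so at each index `n` masses can be handled by exact rational sums,
  -- without limits.
  seq-sumOver : ∀ (xs : List A) f n → seq (sumOver xs f) n ≡ sum xs (λ x → seq (f x) n)
  seq-sumOver []       f n = refl
  seq-sumOver (x ∷ xs) f n = cong (seq (f x) n ℚ.+_) (seq-sumOver xs f n)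

  sum-cong : ∀ (xs : List A) {f g} → (∀ {x} → x ∈ xs → f x ≡ g x) → sum xs f ≡ sum xs g
  sum-cong []       f≡g = refl
  sum-cong (x ∷ xs) f≡g = cong₂ ℚ._+_ (f≡g (here refl)) (sum-cong xs (f≡g ∘ there))

  sum-zero : ∀ (xs : List A) {f} → (∀ {x} → x ∈ xs → f x ≡ 0ℚ) → sum xs f ≡ 0ℚ
  sum-zero []       f≡0 = refl
  sum-zero (x ∷ xs) f≡0 = cong₂ ℚ._+_ (f≡0 (here refl)) (sum-zero xs (f≡0 ∘ there))

  sum-+ : ∀ (xs : List A) f g → sum xs (λ x → f x ℚ.+ g x) ≡ sum xs f ℚ.+ sum xs g
  sum-+ []       f g = refl
  sum-+ (x ∷ xs) f g = trans (cong ((f x ℚ.+ g x) ℚ.+_) (sum-+ xs f g))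
    (S.solve 4 (λ a b c d → (a S.:+ b) S.:+ (c S.:+ d) S.:= (a S.:+ c) S.:+ (b S.:+ d)) refl
      (f x) (g x) (sum xs f) (sum xs g))

  sum-* : ∀ (xs : List A) c f → sum xs (λ x → c ℚ.* f x) ≡ c ℚ.* sum xs f
  sum-* []       c f = sym (ℚ.*-zeroʳ c)
  sum-* (x ∷ xs) c f = trans (cong (c ℚ.* f x ℚ.+_) (sum-* xs c f))
                             (sym (ℚ.*-distribˡ-+ c (f x) (sum xs f)))

  sum-select : ∀ {xs : List A} {K} f → Unique xs → K ∈ xs →
               (∀ {x} → K ≢ x → f x ≡ 0ℚ) → sum xs f ≡ f K
  sum-select {x ∷ xs} f (x∉xs ∷ _) (here refl) f≡0 =
    trans (cong (f x ℚ.+_) (sum-zero xs (λ y∈xs → f≡0 (All.lookup x∉xs y∈xs))))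
          (ℚ.+-identityʳ (f x))
  sum-select {x ∷ xs} f (x∉xs ∷ unq) (there K∈xs) f≡0 =
    trans (cong₂ ℚ._+_ (f≡0 (All.lookup x∉xs K∈xs ∘ sym)) (sum-select f unq K∈xs f≡0))
          (ℚ.+-identityˡ (f _))

sum-swap : ∀ {A B : Set} (xs : List A) (ys : List B) (f : A → B → ℚ) →
           sum ys (λ y → sum xs (λ x → f x y)) ≡ sum xs (λ x → sum ys (f x))
sum-swap []       ys f = sum-zero ys (λ _ → refl)
sum-swap (x ∷ xs) ys f = trans (sum-+ ys (f x) (λ y → sum xs (λ x → f x y)))
                               (cong (sum ys (f x) ℚ.+_) (sum-swap xs ys f))

-- A kernel whose rows sum to 1 preserves total mass: exchange the two sums and factor `m x` out of
-- each row.
sum-stochastic : ∀ {A B : Set} (xs : List A) (ys : List B) (m : A → ℚ) (p : A → B → ℚ) →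
  (∀ {x} → x ∈ xs → sum ys (p x) ≡ 1ℚ) →
  sum ys (λ y → sum xs (λ x → m x ℚ.* p x y)) ≡ sum xs m
sum-stochastic xs ys m p p≡1 = trans (sum-swap xs ys (λ x y → m x ℚ.* p x y))
  (sum-cong xs (λ {x} x∈ → trans (sum-* ys (m x) (p x))
    (trans (cong (m x ℚ.*_) (p≡1 x∈)) (ℚ.*-identityʳ (m x)))))

-- Mass of the computation

δ-self : ∀ M n → seq (δ[ M ] M) n ≡ 1ℚ
δ-self M n with M ≟ M
... | yes _  = refl
... | no M≢M = contradiction refl M≢M

sum-δ : ∀ {xs K} n → Unique xs → K ∈ xs → sum xs (λ N → seq (δ[ K ] N) n) ≡ 1ℚ
sum-δ {K = K} n unq K∈xs =
  trans (sum-select _ unq K∈xs (λ K≢N → δ≐0 K≢N n)) (δ-self K n)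

-- The two Dirac masses are summed separately, so `LO` and `RI` may coincide. The weights add up to
-- 1 at every index, even where an approximant of `ε` lies outside the unit interval.
sum-ℙ : ∀ ε {L xs} n → Unique xs → (∀ {N} → N ∈ successors L → N ∈ xs) → Reducible L →
        sum xs (λ N → seq (ℙ ε L N) n) ≡ 1ℚ
sum-ℙ ε {L} {xs} n unq succ⊆xs red with reducible? L
... | no ¬red = contradiction red ¬red
... | yes r   = begin
  sum xs (λ N → e ℚ.* lo N ℚ.+ (1ℚ ℚ.- e) ℚ.* ri N)
    ≡⟨ sum-+ xs (λ N → e ℚ.* lo N) (λ N → (1ℚ ℚ.- e) ℚ.* ri N) ⟩
  sum xs (λ N → e ℚ.* lo N) ℚ.+ sum xs (λ N → (1ℚ ℚ.- e) ℚ.* ri N)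
    ≡⟨ cong₂ ℚ._+_ (sum-* xs e lo) (sum-* xs (1ℚ ℚ.- e) ri) ⟩
  e ℚ.* sum xs lo ℚ.+ (1ℚ ℚ.- e) ℚ.* sum xs ri
    ≡⟨ cong₂ (λ p q → e ℚ.* p ℚ.+ (1ℚ ℚ.- e) ℚ.* q)
         (sum-δ n unq (succ⊆xs (here refl))) (sum-δ n unq (succ⊆xs (there (here refl)))) ⟩
  e ℚ.* 1ℚ ℚ.+ (1ℚ ℚ.- e) ℚ.* 1ℚ
    ≡⟨ S.solve 1 (λ e → e S.:* S.con 1ℚ S.:+ (S.con 1ℚ S.:- e) S.:* S.con 1ℚ S.:= S.con 1ℚ)
         refl e ⟩
  1ℚ ∎
  where
  open ≡-Reasoning
  e = seq (value ε) n
  lo ri : Term → ℚ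
  lo N = seq (δ[ LO L r ] N) n
  ri N = seq (δ[ RI L r ] N) n

seq-total : ∀ ρ n → seq (total ρ) n ≡ sum (support ρ) (λ N → seq (mass ρ N) n)
seq-total ρ = seq-sumOver (support ρ) (mass ρ)

seq-stepMass : ∀ ε ρ N n →
  seq (stepMass ε ρ N) n ≡ sum (support ρ) (λ L → seq (mass ρ L) n ℚ.* seq (ℙ ε L N) n)
seq-stepMass ε ρ N = seq-sumOver (support ρ) (λ L → mass ρ L *ℝ ℙ ε L N)

-- Mass is lost only at normal forms, whose rows in the kernel are zero; on a reducible support
-- every row sums to 1.
total-step : ∀ ε ρ n → (∀ {L} → L ∈ support ρ → Reducible L) →
             seq (total (step ε ρ)) n ≡ seq (total ρ) n
total-step ε ρ n red = begin
  seq (total (step ε ρ)) n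
    ≡⟨ seq-total (step ε ρ) n ⟩
  sum ys (λ N → seq (stepMass ε ρ N) n)
    ≡⟨ sum-cong ys (λ {N} _ → seq-stepMass ε ρ N n) ⟩
  sum ys (λ N → sum xs (λ L → seq (mass ρ L) n ℚ.* seq (ℙ ε L N) n))
    ≡⟨ sum-stochastic xs ys (λ L → seq (mass ρ L) n) (λ L N → seq (ℙ ε L N) n)
         (λ {L} L∈ → sum-ℙ ε n (unique (step ε ρ)) (∈-stepSupport ρ L∈) (red L∈)) ⟩
  sum xs (λ L → seq (mass ρ L) n)
    ≡⟨ seq-total ρ n ⟨
  seq (total ρ) n ∎
  where
  open ≡-Reasoning
  xs = support ρ
  ys = stepSupport ρ

successor-⟶β : ∀ {L N} → N ∈ successors L → L ⟶β N
successor-⟶β {L} N∈ with reducible? L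
successor-⟶β {L} (here refl)         | yes r = leftmost L r , refl
successor-⟶β {L} (there (here refl)) | yes r = rightmost L r , refl

-- Each transition uses up at most one available `LO` step, whichever redex it fires. The invariant
-- covers the whole support list, including terms of mass zero.
support-LOSteps : ∀ ε {M K} → Affine M → ∀ i n → LOSteps (i ℕ.+ n) M K →
  ∀ {N} → N ∈ support (computation ε M i) → Affine N × ∃ (LOSteps n N)
support-LOSteps ε aff zero    n ls (here refl) = aff , _ , ls
support-LOSteps ε {M} {K} aff (suc i) n ls N∈
  with find (∈-concatMap⁻ successors
         (∈-deduplicate⁻ _≟_ (concatMap successors (support (computation ε M i))) N∈))
... | L , L∈ , N∈succ
  -- The count `suc i + n` is read as `i + suc n`: one more step is available before the last
  -- transition.
  with support-LOSteps ε aff i (suc n) (subst (λ k → LOSteps k M K) (sym (ℕ.+-suc i n)) ls) L∈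
     | successor-⟶β N∈succ
... | affL , _ , lsL | S , refl = affine-fire affL S , LOSteps-fire n affL lsL S

total≡1 : ∀ ε {M K} → Affine M → ∀ i → LOSteps i M K →
          ∀ n → seq (total (computation ε M i)) n ≡ 1ℚ
total≡1 ε {M} aff zero    ls n = trans (ℚ.+-identityʳ _) (δ-self M n)
total≡1 ε {M} {K} aff (suc i) ls n = trans
  (total-step ε (computation ε M i) n reducible)
  (total≡1 ε aff i (proj₂ (LOSteps-init ls)) n)
  where
  reducible : ∀ {L} → L ∈ support (computation ε M i) → Reducible L
  -- With `i + 1` steps from `M`, one step is still available at time `i`, which makes `L`
  -- reducible.
  reducible L∈ with support-LOSteps ε aff i 1 (subst (λ k → LOSteps k M K) (ℕ.+-comm 1 i) ls) L∈
  ... | _ , _ , _∷_ {R = R} _ _ = fire R , R , refl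

-- Partial sums of the expected length at ε = 1

lengthSum : Term → UnitInterval → ℕ → ℝ
lengthSum M ε = partialSum λ i → total (computation ε M (suc i))

-- The support still lists the `RI` reducts, with mass zero, so concentration is expressed through
-- `mass`; membership of `K` is what `sum-select` asks for.
Concentrated : FinSupp → Term → Set
Concentrated ρ K = K ∈ support ρ × (∀ N n → seq (mass ρ N) n ≡ seq (δ[ K ] N) n)

Massless : FinSupp → Set
Massless ρ = ∀ N n → seq (mass ρ N) n ≡ 0ℚ

massless-total : ∀ ρ → Massless ρ → ∀ n → seq (total ρ) n ≡ 0ℚ
massless-total ρ mass≡0 n = trans (seq-total ρ n) (sum-zero (support ρ) (λ {N} _ → mass≡0 N n))

massless-step : ∀ ε ρ → Massless ρ → Massless (step ε ρ)
massless-step ε ρ mass≡0 N n = trans (seq-stepMass ε ρ N n) (sum-zero (support ρ) (λ {L} _ →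
  trans (cong (ℚ._* seq (ℙ ε L N) n) (mass≡0 L n)) (ℚ.*-zeroˡ (seq (ℙ ε L N) n))))

concentrated-step : ∀ ε ρ {K} → Concentrated ρ K →
                    ∀ N n → seq (mass (step ε ρ) N) n ≡ seq (ℙ ε K N) n
concentrated-step ε ρ {K} (K∈ , mass≡δ) N n = begin
  seq (stepMass ε ρ N) n
    ≡⟨ seq-stepMass ε ρ N n ⟩
  sum (support ρ) (λ L → seq (mass ρ L) n ℚ.* seq (ℙ ε L N) n)
    ≡⟨ sum-select (λ L → seq (mass ρ L) n ℚ.* seq (ℙ ε L N) n) (unique ρ) K∈ (λ {L} K≢L →
         trans (cong (ℚ._* seq (ℙ ε L N) n) (trans (mass≡δ L n) (δ≐0 K≢L n)))
               (ℚ.*-zeroˡ (seq (ℙ ε L N) n))) ⟩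
  seq (mass ρ K) n ℚ.* seq (ℙ ε K N) n
    ≡⟨ cong (ℚ._* seq (ℙ ε K N) n) (trans (mass≡δ K n) (δ-self K n)) ⟩
  1ℚ ℚ.* seq (ℙ ε K N) n
    ≡⟨ ℚ.*-identityˡ (seq (ℙ ε K N) n) ⟩
  seq (ℙ ε K N) n ∎
  where open ≡-Reasoning

ℙ-cases : ∀ ε K →
  (∃ λ r → LO K r ∈ successors K × (∀ N n → seq (ℙ ε K N) n ≡ seq (P ε K r N) n))
  ⊎ (∀ N n → seq (ℙ ε K N) n ≡ 0ℚ)
ℙ-cases ε K with reducible? K
... | yes r = inj₁ (r , here refl , λ _ _ → refl)
... | no  _ = inj₂ (λ _ _ → refl)

-- Asks for 1 at every index rather than in the limit, so that partial sums can be compared as equal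
-- rational sequences.
AlwaysLO : UnitInterval → Set
AlwaysLO ε = ∀ n → seq (value ε) n ≡ 1ℚ

P-LO : ∀ ε → AlwaysLO ε → ∀ M r N n → seq (P ε M r N) n ≡ seq (δ[ LO M r ] N) n
P-LO ε ε≡1 M r N n = trans
  (cong (λ e → e ℚ.* p ℚ.+ (1ℚ ℚ.- e) ℚ.* q) (ε≡1 n))
  (S.solve 2 (λ p q → S.con 1ℚ S.:* p S.:+ (S.con 1ℚ S.:- S.con 1ℚ) S.:* q S.:= p) refl p q)
  where
  p = seq (δ[ LO M r ] N) n
  q = seq (δ[ RI M r ] N) n

concentrated-LO : ∀ ε → AlwaysLO ε → ∀ ρ {K} → Concentrated ρ K →
  (∃ λ (R : Redex K) → IsLO R × Concentrated (step ε ρ) (fire R)) ⊎ Massless (step ε ρ)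
concentrated-LO ε ε≡1 ρ {K} conc = Sum.map
  (λ (r , LO∈ , ℙ≡P) → leftmost K r , leftmost-IsLO K r ,
    ∈-stepSupport ρ (proj₁ conc) LO∈ , λ N n →
      trans (concentrated-step ε ρ conc N n) (trans (ℙ≡P N n) (P-LO ε ε≡1 K r N n)))
  (λ ℙ≡0 N n → trans (concentrated-step ε ρ conc N n) (ℙ≡0 N n))
  (ℙ-cases ε K)

Running : Term → UnitInterval → ℕ → Set
Running M ε n = ∃ λ K → LOSteps n M K × Concentrated (computation ε M n) K

-- `l` is the length of an `LO` run from `M` at which the partial sums froze; `Massless` keeps them
-- frozen afterwards.
Stopped : Term → UnitInterval → ℕ → Set
Stopped M ε n =
  (∃ λ l → ∃ (LOSteps l M) × (∀ k → seq (lengthSum M ε n) k ≡ seq (lengthSum M ε l) k))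
  × Massless (computation ε M n)

lengthSum-massless : ∀ M ε n → Massless (computation ε M (suc n)) →
                     ∀ k → seq (lengthSum M ε (suc n)) k ≡ seq (lengthSum M ε n) k
lengthSum-massless M ε n mass≡0 k = trans
  (cong (seq (lengthSum M ε n) k ℚ.+_) (massless-total (computation ε M (suc n)) mass≡0 k))
  (ℚ.+-identityʳ (seq (lengthSum M ε n) k))

running-suc : ∀ M ε → AlwaysLO ε → ∀ n → Running M ε n → Running M ε (suc n) ⊎ Stopped M ε (suc n)
running-suc M ε ε≡1 n (K , ls , conc) = Sum.map
  (λ (R , lo , conc′) → fire R , ls ∷ʳ lo , conc′)
  -- `lengthSum` at `n` adds the totals at times 1 to `n`, so a mass vanishing at time `suc n`
  -- freezes the sum at length `n`.
  (λ mass≡0 → (n , (K , ls) , lengthSum-massless M ε n mass≡0) , mass≡0)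
  (concentrated-LO ε ε≡1 (computation ε M n) conc)

stopped-suc : ∀ M ε n → Stopped M ε n → Stopped M ε (suc n)
stopped-suc M ε n ((l , ls , eq) , mass≡0) =
  (l , ls , λ k → trans (lengthSum-massless M ε n mass′≡0 k) (eq k)) , mass′≡0
  where mass′≡0 = massless-step ε (computation ε M n) mass≡0

running-or-stopped : ∀ M ε → AlwaysLO ε → ∀ n → Running M ε n ⊎ Stopped M ε n
running-or-stopped M ε ε≡1 zero    = inj₁ (M , [] , here refl , λ _ _ → refl)
running-or-stopped M ε ε≡1 (suc n) =
  Sum.[ running-suc M ε ε≡1 n , inj₂ ∘ stopped-suc M ε n ] (running-or-stopped M ε ε≡1 n)

lengthSum-LOSteps : ∀ {M} → Affine M → ∀ ε ε′ n {K} → LOSteps n M K → ∀ k →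
                    seq (lengthSum M ε n) k ≡ seq (lengthSum M ε′ n) k
lengthSum-LOSteps aff ε ε′ zero    ls k = refl
lengthSum-LOSteps aff ε ε′ (suc n) ls k = cong₂ ℚ._+_
  (lengthSum-LOSteps aff ε ε′ n (proj₂ (LOSteps-init ls)) k)
  (trans (total≡1 ε aff (suc n) ls k) (sym (total≡1 ε′ aff (suc n) ls k)))

-- While the run goes on, the witness is `n` itself; after it has stopped, it is the length recorded
-- in `Stopped`. Up to that length every total is 1 for both parameters.
lengthSum-attained : ∀ {M} → Affine M → ∀ ε → AlwaysLO ε → ∀ ε′ n →
  ∃ λ l → ∀ k → seq (lengthSum M ε n) k ≡ seq (lengthSum M ε′ l) k
lengthSum-attained {M} aff ε ε≡1 ε′ n = Sum.[
  (λ (_ , ls , _) → n , lengthSum-LOSteps aff ε ε′ n ls) ,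
  (λ ((l , (_ , ls) , eq) , _) → l , λ k → trans (eq k) (lengthSum-LOSteps aff ε ε′ l ls k)) ]
  (running-or-stopped M ε ε≡1 n)

-- A rational lies below `ExpLen` when it lies below some partial sum; the equal partial sum for
-- `ε′` admits the same `δ` and `K`.
ExpLen-minimal : ∀ {M} → Affine M → ∀ ε → AlwaysLO ε → ∀ ε′ → ExpLen M ε ≤∞ ExpLen M ε′
ExpLen-minimal {M} aff ε ε≡1 ε′ q (n , δ , 0<δ , K , h) =
  let l , eq = lengthSum-attained aff ε ε≡1 ε′ n
  in l , δ , 0<δ , K , λ k K≤k → subst (q ℚ.+ δ ℚ.≤_) (eq k) (h k K≤k)

corollary1 : (M : Term) → Affine M → (ε : UnitInterval) → ExpLen M 1ᴵ ≤∞ ExpLen M ε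
corollary1 M aff ε = ExpLen-minimal aff 1ᴵ (λ _ → refl) ε
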